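{- Let $\theta=(\alpha,\beta,\gamma)\in S_n\times S_n\times S_n$ be an autotopism of a Latin square $L$ of order $n$. If $i$ belongs to an $a$-cycle of $\alpha$ and $j$ belongs to a $b$-cycle of $\beta$, then $L(i,j)$ belongs to a $c$-cycle of $\gamma$, where $\mathrm{lcm}(a,b)=\mathrm{lcm}(b,c)=\mathrm{lcm}(a,c)=\mathrm{lcm}(a,b,c)$.
   Context: A Latin square of order $n$ is an $n\times n$ array $L=L(i,j)$ with rows, columns and symbols indexed by $[n]=\{1,\dots,n\}$ such that the symbols in every row and in every column are distinct. A triple $(\alpha,\beta,\gamma)\in S_n\times S_n\times S_n$ is an autotopism of $L$ if $\gamma(L(i,j))=L(\alpha(i),\beta(j))$ for all $i,j\in[n]$. A $c$-cycle is a cycle of length $c$ in the disjoint cycle decomposition; fixed points are cycles of length $1$. -}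

module Defs where

open import Data.Fin using (Fin)
open import Data.Fin.Permutation using (Permutation′; _⟨$⟩ʳ_)
open import Data.List using (List; _∷_; _∷ʳ_; map; concat; length; allFin)
open import Data.List.Membership.Propositional using (_∈_)
open import Data.List.Relation.Binary.Permutation.Propositional using (_↭_)
open import Data.List.Relation.Unary.All using (All)
open import Data.Nat using (ℕ)
open import Data.Product using (Σ-syntax; ∃-syntax; _×_; _,_)
open import Function.Definitions using (Injective)
open import Relation.Binary.PropositionalEquality using (_≡_)

-- Rows, columns and symbols are indexed by Fin n in place of {1,…,n}.
record LatinSquare (n : ℕ) : Set where
  field
    entry        : Fin n → Fin n → Fin n
    row-distinct : ∀ i → Injective _≡_ _≡_ (λ j → entry i j)
    col-distinct : ∀ j → Injective _≡_ _≡_ (λ i → entry i j)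

open LatinSquare public

IsAutotopism : ∀ {n} → LatinSquare n →
               Permutation′ n × Permutation′ n × Permutation′ n → Set
IsAutotopism L (α , β , γ) =
  ∀ i j → γ ⟨$⟩ʳ entry L i j ≡ entry L (α ⟨$⟩ʳ i) (β ⟨$⟩ʳ j)

-- The nonempty word x₀ x₁ … x₍c₋₁₎ stands for the cycle
-- x₀ ↦ x₁ ↦ … ↦ x₍c₋₁₎ ↦ x₀: applying σ letterwise rotates the word by one
-- place.  A one-letter word is a fixed point.  Distinctness of the letters is
-- imposed in CycleDecomposition.
data CyclesAlong {n} (σ : Permutation′ n) : List (Fin n) → Set where
  cyclesAlong : ∀ {x xs} → map (σ ⟨$⟩ʳ_) (x ∷ xs) ≡ xs ∷ʳ x →
                CyclesAlong σ (x ∷ xs)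

-- Since allFin n lists every element exactly once, `partition` says that the
-- letters within each cycle are distinct, that different cycles are disjoint,
-- and that every element (fixed points included) occurs in some cycle.
-- The decomposition is unique only up to reordering the cycles and rotating
-- each word, neither of which affects lengths or membership.
record CycleDecomposition {n} (σ : Permutation′ n) : Set where
  field
    cycles    : List (List (Fin n))
    along     : All (CyclesAlong σ) cycles
    partition : concat cycles ↭ allFin n

open CycleDecomposition public

InCycle : ∀ {n} → Permutation′ n → ℕ → Fin n → Set
InCycle σ c i =
  Σ[ D ∈ CycleDecomposition σ ] ∃[ w ] w ∈ cycles D × length w ≡ c × i ∈ w

{-# OPTIONS --safe #-}
-- The length c of the cycle through x is characterised by: the k-th power of
-- the permutation fixes x exactly when c divides k.  The powers of an
-- autotopism are autotopisms, and two of i, j, L(i,j) determine the third, so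
-- a power fixing two of them fixes all three.  Hence each of a, b, c divides
-- the lcm of the other two.
module Submission where

open import Defs
open import Data.Nat using (ℕ; zero; suc; _+_; _*_; _∸_; _<_; s<s⁻¹)
open import Data.Nat.DivMod using (_%_; _/_; m≡m%n+[m/n]*n; m%n<n)
open import Data.Nat.Divisibility using (_∣_; divides; m%n≡0⇒n∣m; ∣-antisym; ∣-trans)
open import Data.Nat.GeneralisedArithmetic using (fold; fold-+)
open import Data.Nat.LCM using (lcm; lcm-least; m∣lcm[m,n]; n∣lcm[m,n])
open import Data.Nat.Properties using (+-comm; m∸n+n≡m; m<n⇒0<n∸m; <⇒≤; n<1+n; ≤-<-trans; m∸n≤m)
open import Data.Fin using (Fin; toℕ)
open import Data.Fin.Permutation using (Permutation′; _⟨$⟩ʳ_)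
open import Data.Fin.Properties using (_≟_; pigeonhole)
open import Data.List using (List; []; _∷_; _++_; _∷ʳ_; map; concat; length; allFin; applyUpTo)
open import Data.List.Membership.DecPropositional using (_∈?_)
open import Data.List.Membership.Propositional using (_∈_)
open import Data.List.Membership.Propositional.Properties
  using (∈-map⁻; ∈-++⁺ʳ; ∈-concat⁺′; ∈-concat⁻′; ∈-applyUpTo⁺; ∈-applyUpTo⁻; ∈-allFin)
open import Data.List.Membership.Propositional.Properties.WithK using (unique∧set⇒bag)
open import Data.List.Properties using (map-applyUpTo; applyUpTo-∷ʳ; ∷-injective)
open import Data.List.Relation.Binary.BagAndSetEquality using (∼bag⇒↭)
open import Data.List.Relation.Binary.Permutation.Propositional using (↭-sym; ↭⇒↭ₛ)
open import Data.List.Relation.Binary.Permutation.Propositional.Properties using (∈-resp-↭; ∷↭∷ʳ)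
import Data.List.Relation.Binary.Permutation.Setoid.Properties as PermutationSetoid
open import Data.List.Relation.Unary.All as All using (All; []; _∷_)
open import Data.List.Relation.Unary.All.Properties using (++⁻ˡ)
open import Data.List.Relation.Unary.AllPairs using ([]; _∷_)
open import Data.List.Relation.Unary.Any using (here; there)
open import Data.List.Relation.Unary.Unique.Propositional using (Unique)
open import Data.List.Relation.Unary.Unique.Propositional.Properties
  using (++⁺; allFin⁺; applyUpTo⁺₁; Unique[x∷xs]⇒x∉xs)
open import Data.Product using (∃-syntax; _×_; _,_; proj₁)
open import Function using (_∘_; _⇔_; mk⇔; Equivalence; Injection)
open import Function.Definitions using (Injective)
open import Function.Properties.Inverse using (↔⇒↣)
open import Relation.Binary.PropositionalEquality
  using (_≡_; _≢_; refl; sym; trans; cong; cong₂; subst; setoid; module ≡-Reasoning)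
open import Relation.Nullary using (¬_; yes; no; contradiction)
open import Relation.Unary using (Decidable)

open Equivalence using (to; from)

-- Least witnesses and duplicate-free lists.

least : ∀ {P : ℕ → Set} → Decidable P → ∀ m → P m →
        ∃[ k ] P k × (∀ {j} → j < k → ¬ P j)
least P? m Pm with P? 0
... | yes P0 = 0 , P0 , λ ()
least P? zero Pm | no ¬P0 = contradiction Pm ¬P0
least {P} P? (suc m) Pm | no ¬P0 with k , Pk , min ← least (P? ∘ suc) m Pm =
  suc k , Pk , below
  where
  below : ∀ {j} → j < suc k → ¬ P j
  below {zero}  _   = ¬P0
  below {suc j} j<k = min (s<s⁻¹ j<k)

Unique-++⁻ˡ : ∀ {A : Set} xs {ys : List A} → Unique (xs ++ ys) → Unique xs
Unique-++⁻ˡ []       _          = []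
Unique-++⁻ˡ (x ∷ xs) (x∉ ∷ xs!) = ++⁻ˡ xs x∉ ∷ Unique-++⁻ˡ xs xs!

Unique-++⁻ʳ : ∀ {A : Set} xs {ys : List A} → Unique (xs ++ ys) → Unique ys
Unique-++⁻ʳ []       ys!       = ys!
Unique-++⁻ʳ (x ∷ xs) (_ ∷ xs!) = Unique-++⁻ʳ xs xs!

Unique-concat⁻ : ∀ {A : Set} {xs : List A} xss → Unique (concat xss) → xs ∈ xss → Unique xs
Unique-concat⁻ (xs ∷ _)   u (here refl)   = Unique-++⁻ˡ xs u
Unique-concat⁻ (xs ∷ xss) u (there xs∈xss) = Unique-concat⁻ xss (Unique-++⁻ʳ xs u) xs∈xss

-- Iteration, orbit words and periods.

Period : {A : Set} → (A → A) → A → ℕ → Set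
Period f x c = ∀ k → fold x f k ≡ x ⇔ c ∣ k

-- Comparing heads in the rotation equation shows that each letter is the image of the one before
-- it. An arbitrary sequence `g` stands for the iterates so that the induction can restart at the
-- second letter with `g ∘ suc`, while `z` stays the closing letter.
rotation⇒applyUpTo : ∀ {A : Set} {f : A → A} (g : ℕ → A) → (∀ k → g (suc k) ≡ f (g k)) →
  ∀ ys {z} → map f (g 0 ∷ ys) ≡ ys ∷ʳ z →
  g 0 ∷ ys ≡ applyUpTo g (suc (length ys)) × g (suc (length ys)) ≡ z
rotation⇒applyUpTo g step []       eq = refl , trans (step 0) (proj₁ (∷-injective eq))
rotation⇒applyUpTo g step (y ∷ ys) eq
  with fg0≡y , eq′ ← ∷-injective eq
  with refl ← trans (step 0) fg0≡y
  with word , end ← rotation⇒applyUpTo (g ∘ suc) (step ∘ suc) ys eq′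
  = cong (g 0 ∷_) word , end

module _ {A : Set} {f : A → A} (f-injective : Injective _≡_ _≡_ f) where

  fold-injective : ∀ k {x y} → fold x f k ≡ fold y f k → x ≡ y
  fold-injective zero    eq = eq
  fold-injective (suc k) eq = fold-injective k (f-injective eq)

  fold-cancel : ∀ x {j k} → j < k → fold x f j ≡ fold x f k → fold x f (k ∸ j) ≡ x
  fold-cancel x {j} {k} j<k eq = sym (fold-injective j (begin
    fold x f j                   ≡⟨ eq ⟩
    fold x f k                   ≡⟨ cong (fold x f) (m∸n+n≡m (<⇒≤ j<k)) ⟨
    fold x f (k ∸ j + j)         ≡⟨ cong (fold x f) (+-comm (k ∸ j) j) ⟩
    fold x f (j + (k ∸ j))       ≡⟨ fold-+ x f j ⟩
    fold (fold x f (k ∸ j)) f j  ∎))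
    where open ≡-Reasoning

  fold-multiple : ∀ {x} c → fold x f c ≡ x → ∀ q → fold x f (q * c) ≡ x
  fold-multiple c eq zero    = refl
  fold-multiple {x} c eq (suc q) =
    trans (fold-+ x f c) (trans (cong (λ y → fold y f c) (fold-multiple c eq q)) eq)

  -- Iterates commute and the `m`-th one is injective, so a power fixes `x` iff it fixes its `m`-th
  -- iterate. This carries the period from the first letter of a cycle to every other letter.
  period-fold : ∀ {x c} m → Period f x c → Period f (fold x f m) c
  period-fold {x} m per k = mk⇔
    (λ eq → to (per k) (fold-injective m (trans (swap k) eq)))
    (λ c∣k → trans (sym (swap k)) (cong (λ y → fold y f m) (from (per k) c∣k)))
    where
    swap : ∀ k → fold (fold x f k) f m ≡ fold (fold x f m) f k
    swap k = trans (sym (fold-+ x f m))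
                   (trans (cong (fold x f) (+-comm m k)) (fold-+ x f k))

  -- Division with remainder by `suc c` reduces a return at time `k` to one at the remainder, and
  -- distinctness of the letters forces the remainder to be zero.
  unique⇒period : ∀ x c → Unique (applyUpTo (fold x f) (suc c)) →
                  fold x f (suc c) ≡ x → Period f x (suc c)
  unique⇒period x c u eq k = mk⇔ fixed⇒∣ λ where (divides q refl) → fold-multiple (suc c) eq q
    where
    fixed-remainder : fold x f k ≡ x → fold x f (k % suc c) ≡ x
    fixed-remainder fk≡x = begin
      fold x f r                       ≡⟨ cong (λ y → fold y f r) (fold-multiple (suc c) eq q) ⟨
      fold (fold x f (q * suc c)) f r  ≡⟨ fold-+ x f r ⟨
      fold x f (r + q * suc c)         ≡⟨ cong (fold x f) (m≡m%n+[m/n]*n k (suc c)) ⟨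
      fold x f k                       ≡⟨ fk≡x ⟩
      x                                ∎
      where
      open ≡-Reasoning
      r = k % suc c
      q = k / suc c

    no-return : ∀ r → r < suc c → fold x f r ≡ x → r ≡ 0
    no-return zero    _   _  = refl
    -- A positive remainder would put `x` into the tail of the word that starts with `x`.
    no-return (suc r) r<c fr≡x = contradiction
      (subst (_∈ applyUpTo (fold x f ∘ suc) c) fr≡x (∈-applyUpTo⁺ (fold x f ∘ suc) (s<s⁻¹ r<c)))
      (Unique[x∷xs]⇒x∉xs u)

    fixed⇒∣ : fold x f k ≡ x → suc c ∣ k
    fixed⇒∣ fk≡x =
      m%n≡0⇒n∣m k (suc c) (no-return (k % suc c) (m%n<n k (suc c)) (fixed-remainder fk≡x))

-- Cycles of a permutation and existence of a cycle decomposition.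

module _ {n} (σ : Permutation′ n) where

  private
    f : Fin n → Fin n
    f = σ ⟨$⟩ʳ_

    f-injective : Injective _≡_ _≡_ f
    f-injective = Injection.injective (↔⇒↣ σ)

  InCycle⇒Period : ∀ {c x} → InCycle σ c x → Period f x c
  InCycle⇒Period {x = x} (D , w , w∈D , refl , x∈w) with All.lookup (along D) w∈D
  ... | cyclesAlong {y} {ys} rot
    with word , end ← rotation⇒applyUpTo (fold y f) (λ _ → refl) ys rot
    -- The word lists the orbit of its first letter `y`, so `x` is the `m`-th iterate of `y`.
    with m , _ , refl ← ∈-applyUpTo⁻ (fold y f) (subst (x ∈_) word x∈w)
    = period-fold f-injective m (unique⇒period f-injective y (length ys) (subst Unique word w!) end)
    where
    w! : Unique (y ∷ ys)
    w! = Unique-concat⁻ (cycles D)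
      (PermutationSetoid.Unique-resp-↭ (setoid (Fin n)) (↭⇒↭ₛ (↭-sym (partition D))) (allFin⁺ n))
      w∈D

  first-return : ∀ x → ∃[ c ] fold x f (suc c) ≡ x × (∀ {j} → j < c → fold x f (suc j) ≢ x)
  first-return x with pigeonhole (n<1+n n) (fold x f ∘ toℕ)
  -- Two of the first `n + 1` iterates coincide; cancelling the earlier one gives a return after a
  -- positive time. The search then runs over predecessors of return times, which excludes the
  -- trivial return at time 0.
  ... | i , j , i<j , eq with toℕ j ∸ toℕ i | m<n⇒0<n∸m i<j | fold-cancel f-injective x i<j eq
  ...   | suc d | _ | ret = least (λ k → fold x f (suc k) ≟ x) d ret

  orbit : ∀ x → ∃[ c ] CyclesAlong σ (applyUpTo (fold x f) (suc c))
                     × Unique (applyUpTo (fold x f) (suc c))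
  orbit x with c , ret , min ← first-return x = c , cyclesAlong rot , distinct
    where
    open ≡-Reasoning
    g = fold x f

    rot : map f (applyUpTo g (suc c)) ≡ applyUpTo (g ∘ suc) c ∷ʳ x
    rot = begin
      map f (applyUpTo g (suc c))            ≡⟨ map-applyUpTo g f (suc c) ⟩
      applyUpTo (g ∘ suc) (suc c)            ≡⟨ applyUpTo-∷ʳ (g ∘ suc) c ⟨
      applyUpTo (g ∘ suc) c ∷ʳ g (suc c)     ≡⟨ cong (applyUpTo (g ∘ suc) c ∷ʳ_) ret ⟩
      applyUpTo (g ∘ suc) c ∷ʳ x             ∎

    no-return : ∀ {d} → 0 < d → d < suc c → g d ≢ x
    no-return {suc d} _ d<c = min (s<s⁻¹ d<c)

    distinct : Unique (applyUpTo g (suc c))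
    -- A repeated letter would cancel to a return at time `j ∸ i`, before the first return.
    distinct = applyUpTo⁺₁ g (suc c) λ {i} {j} i<j j<c eq →
      no-return (m<n⇒0<n∸m i<j) (≤-<-trans (m∸n≤m j i) j<c) (fold-cancel f-injective x i<j eq)

  -- The images of the letters form a rotation of the word, so `f y` is the image of some letter,
  -- which is `y` by injectivity.
  CyclesAlong-closed⁻ : ∀ {w y} → CyclesAlong σ w → f y ∈ w → y ∈ w
  CyclesAlong-closed⁻ {y = y} (cyclesAlong {x} {xs} rot) fy∈w
    with z , z∈w , fy≡fz ← ∈-map⁻ f (subst (f y ∈_) (sym rot) (∈-resp-↭ (∷↭∷ʳ x xs) fy∈w))
    with refl ← f-injective fy≡fz = z∈w

  concat-closed⁻ : ∀ {cs y} → All (CyclesAlong σ) cs → ∀ k → fold y f k ∈ concat cs → y ∈ concat cs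
  concat-closed⁻ al zero    y∈ = y∈
  concat-closed⁻ {cs} al (suc k) fy∈ with w , fy∈w , w∈cs ← ∈-concat⁻′ cs fy∈ =
    concat-closed⁻ al k (∈-concat⁺′ (CyclesAlong-closed⁻ (All.lookup al w∈cs) fy∈w) w∈cs)

  -- Cycles are collected greedily: the orbit of `x` is added only if `x` is not yet covered. It is
  -- then disjoint from the earlier cycles, since these are closed under preimages and a common
  -- letter could be traced back to `x`.
  cover : ∀ xs → ∃[ cs ] All (CyclesAlong σ) cs × Unique (concat cs) × All (_∈ concat cs) xs
  cover []       = [] , [] , [] , []
  cover (x ∷ xs) with cs , al , u , xs⊆ ← cover xs | _∈?_ _≟_ x (concat cs)
  ... | yes x∈ = cs , al , u , x∈ ∷ xs⊆
  ... | no  x∉ with c , alw , w! ← orbit x =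
    w ∷ cs , alw ∷ al , ++⁺ w! u disjoint , here refl ∷ All.map (∈-++⁺ʳ w) xs⊆
    where
    w = applyUpTo (fold x f) (suc c)

    disjoint : ∀ {v} → ¬ (v ∈ w × v ∈ concat cs)
    disjoint (v∈w , v∈cs) with k , _ , refl ← ∈-applyUpTo⁻ (fold x f) v∈w =
      x∉ (concat-closed⁻ al k v∈cs)

  cycleDecomposition : CycleDecomposition σ
  cycleDecomposition with cs , al , u , all∈ ← cover (allFin n) = record
    { cycles    = cs
    ; along     = al
    ; partition = ∼bag⇒↭ (unique∧set⇒bag u (allFin⁺ n)
        (mk⇔ (λ _ → ∈-allFin _) (All.lookup all∈)))
    }

  -- Supplies the length `c` for the symbol in the theorem; `InCycle` asks for an actual
  -- decomposition, hence the construction above.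
  ∃-InCycle : ∀ x → ∃[ c ] InCycle σ c x
  ∃-InCycle x
    with w , x∈w , w∈D ← ∈-concat⁻′ (cycles cycleDecomposition)
           (∈-resp-↭ (↭-sym (partition cycleDecomposition)) (∈-allFin x))
    = length w , cycleDecomposition , w , w∈D , refl , x∈w

-- Least common multiples and powers of autotopisms.

lcm-of-two : ∀ {a b c} → a ∣ lcm b c → b ∣ lcm a c → c ∣ lcm a b →
  lcm a b ≡ lcm b c × lcm b c ≡ lcm a c × lcm a c ≡ lcm (lcm a b) c
-- Each pairwise lcm is a common multiple of all three numbers, so the lcms divide one another.
lcm-of-two {a} {b} {c} a∣bc b∣ac c∣ab =
    ∣-antisym (lcm-least a∣bc (m∣lcm[m,n] b c)) (lcm-least (n∣lcm[m,n] a b) c∣ab)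
  , ∣-antisym (lcm-least b∣ac (n∣lcm[m,n] a c)) (lcm-least a∣bc (n∣lcm[m,n] b c))
  , ∣-antisym
      (lcm-least (∣-trans (m∣lcm[m,n] a b) (m∣lcm[m,n] (lcm a b) c)) (n∣lcm[m,n] (lcm a b) c))
      (lcm-least (lcm-least (m∣lcm[m,n] a c) b∣ac) (n∣lcm[m,n] a c))

autotopism-power : ∀ {n} (L : LatinSquare n) (α β γ : Permutation′ n) →
  IsAutotopism L (α , β , γ) → ∀ i j k →
  fold (entry L i j) (γ ⟨$⟩ʳ_) k ≡ entry L (fold i (α ⟨$⟩ʳ_) k) (fold j (β ⟨$⟩ʳ_) k)
autotopism-power L α β γ auto i j zero    = refl
autotopism-power L α β γ auto i j (suc k) =
  trans (cong (γ ⟨$⟩ʳ_) (autotopism-power L α β γ auto i j k)) (auto _ _)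

lemma3p6 : ∀ (n : ℕ) (L : LatinSquare n) (α β γ : Permutation′ n) →
    IsAutotopism L (α , β , γ) →
    ∀ (i j : Fin n) (a b : ℕ) →
    InCycle α a i →
    InCycle β b j →
    ∃[ c ] InCycle γ c (entry L i j)
    × lcm a b ≡ lcm b c
    × lcm b c ≡ lcm a c
    × lcm a c ≡ lcm (lcm a b) c
lemma3p6 n L α β γ auto i j a b i∈a j∈b with c , e∈c ← ∃-InCycle γ (entry L i j) =
  c , e∈c , lcm-of-two
    -- The power `bc` fixes the column and the symbol; distinctness within column `j` recovers the
    -- row.
    (to (perα bc) (col-distinct L j (begin
      entry L (α^ bc) j        ≡⟨ cong (entry L (α^ bc)) (from (perβ bc) (m∣lcm[m,n] b c)) ⟨
      entry L (α^ bc) (β^ bc)  ≡⟨ power bc ⟨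
      γ^ bc                    ≡⟨ from (perγ bc) (n∣lcm[m,n] b c) ⟩
      entry L i j              ∎)))
    -- The power `ac` fixes the row and the symbol; distinctness within row `i` recovers the column.
    (to (perβ ac) (row-distinct L i (begin
      entry L i (β^ ac)        ≡⟨ cong (λ x → entry L x (β^ ac)) (from (perα ac) (m∣lcm[m,n] a c)) ⟨
      entry L (α^ ac) (β^ ac)  ≡⟨ power ac ⟨
      γ^ ac                    ≡⟨ from (perγ ac) (n∣lcm[m,n] a c) ⟩
      entry L i j              ∎)))
    (to (perγ ab) (begin
      γ^ ab                    ≡⟨ power ab ⟩
      entry L (α^ ab) (β^ ab)  ≡⟨ cong₂ (entry L) (from (perα ab) (m∣lcm[m,n] a b))
                                                  (from (perβ ab) (n∣lcm[m,n] a b)) ⟩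
      entry L i j              ∎))
  where
  open ≡-Reasoning
  ab = lcm a b
  bc = lcm b c
  ac = lcm a c
  α^ = fold i (α ⟨$⟩ʳ_)
  β^ = fold j (β ⟨$⟩ʳ_)
  γ^ = fold (entry L i j) (γ ⟨$⟩ʳ_)
  power = autotopism-power L α β γ auto i j
  perα = InCycle⇒Period α i∈a
  perβ = InCycle⇒Period β j∈b
  perγ = InCycle⇒Period γ e∈c
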